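{- Let $c\ge2$, let $\Gamma=(V,E)$ be a $c$-uniform unoriented hypergraph with no isolated vertices, let $k\ge2$ and let $V_1,\dots,V_k$ be the color classes of a proper strong $k$-coloring of $\Gamma$. Then the functions $g_{ij}$ (for all distinct $i,j$) are eigenfunctions of the normalized Laplacian $L$ if and only if for all $i=1,\dots,k$ and all $v\in V$, \[ \bigl|\{e\in E: v\in e,\ e\cap V_i\neq\varnothing\}\bigr|=\begin{cases}\dfrac{(c-1)\deg v}{k-1}, & v\notin V_i,\\[2mm] \deg v, & v\in V_i.\end{cases} \] In this case the corresponding eigenvalue is $\dfrac{k-c}{k-1}$.
   Context: A hypergraph has finite vertex set $V$ and edge set $E\subseteq\mathcal P(V)$; it is $c$-uniform if $|e|=c$ for all $e$, and unoriented means all incidences have orientation $+1$. $\deg v=|\{e\in E: v\in e\}|\ge1$, $D=\mathrm{diag}(\deg v)$, adjacency $A_{v,v}=0$ and $A_{v,w}=-|\{e\in E: v,w\in e\}|$ for $v\ne w$, normalized Laplacian $L=\mathrm{Id}-D^{ -1}A$. A proper strong $k$-coloring is a map $V\to\{1,\dots,k\}$ such that any two distinct vertices in a common edge receive different colors. For color classes $V_1,\dots,V_k$ and distinct $i,j$, $g_{ij}(w)=1$ if $w\in V_i$, $-1$ if $w\in V_j$, $0$ otherwise. -}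

module Defs where

open import Algebra.Apartness.Bundles using (HeytingField; HeytingCommutativeRing)
open import Algebra.Bundles using (CommutativeRing)
import Algebra.Definitions.RawMonoid as RawMonoidDefs
open import Data.Fin.Base using (Fin)
import Data.Fin.Properties as Fin
open import Data.Fin.Subset using (Subset; _∈_; _∉_; _∩_; ∣_∣)
open import Data.Fin.Subset.Properties using (_∈?_; nonempty?)
open import Data.Integer.Base using (+_)
open import Data.List.Base using (List; length; filter)
open import Data.List.Relation.Unary.All using (All)
open import Data.List.Relation.Unary.Unique.Propositional using (Unique)
open import Data.Nat.Base using (ℕ; _∸_; _*_; _≤_; NonZero; >-nonZero; s≤s)
open import Data.Product.Base using (∃-syntax; _×_; proj₁)
open import Data.Rational.Base using (_/_)
open import Data.Vec.Base using (tabulate)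
open import Level using (Level; _⊔_) renaming (suc to lsuc)
open import Relation.Binary.PropositionalEquality.Core using (_≡_; _≢_)
open import Relation.Nullary.Decidable.Core using (does; yes; no; _×-dec_)
open import Relation.Nullary.Negation.Core using (¬_)

-- The edge set is a duplicate-free list of vertex subsets; no notion below
-- depends on the order of the list.
record Hypergraph (n : ℕ) : Set where
  field
    edges  : List (Subset n)
    unique : Unique edges

open Hypergraph public

module _ {n : ℕ} (Γ : Hypergraph n) where

  Uniform : ℕ → Set
  Uniform c = All (λ e → ∣ e ∣ ≡ c) (edges Γ)

  degree : Fin n → ℕ
  degree v = length (filter (v ∈?_) (edges Γ))

  NoIsolatedVertices : Set
  NoIsolatedVertices = ∀ v → 1 ≤ degree v

  codegree : Fin n → Fin n → ℕ
  codegree v w = length (filter (λ e → (v ∈? e) ×-dec (w ∈? e)) (edges Γ))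

  edgesMeeting : Fin n → Subset n → ℕ
  edgesMeeting v S =
    length (filter (λ e → (v ∈? e) ×-dec nonempty? (e ∩ S)) (edges Γ))

  ProperStrongColoring : {k : ℕ} → (Fin n → Fin k) → Set
  ProperStrongColoring κ =
    All (λ e → ∀ v w → v ∈ e → w ∈ e → v ≢ w → κ v ≢ κ w) (edges Γ)

colorClass : {n k : ℕ} → (Fin n → Fin k) → Fin k → Subset n
colorClass κ i = tabulate (λ v → does (κ v Fin.≟ i))

2≤⇒nonZero-pred : {k : ℕ} → 2 ≤ k → NonZero (k ∸ 1)
2≤⇒nonZero-pred (s≤s 1≤k-1) = >-nonZero 1≤k-1

-- The quotient (c - 1) deg v / (k - 1) is a rational number, so the first
-- equation also asserts that k - 1 divides (c - 1) deg v.
CountingCondition : {n : ℕ} (Γ : Hypergraph n) (c : ℕ) {k : ℕ} → 2 ≤ k →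
                    (Fin n → Fin k) → Set
CountingCondition Γ c {k} 2≤k κ = ∀ i v →
    (v ∉ colorClass κ i →
       (+ edgesMeeting Γ v (colorClass κ i)) / 1 ≡ (+ ((c ∸ 1) * degree Γ v)) / (k ∸ 1))
  × (v ∈ colorClass κ i →
       edgesMeeting Γ v (colorClass κ i) ≡ degree Γ v)
  where instance _ = 2≤⇒nonZero-pred 2≤k

-- Stands in for the real numbers as field of scalars: ℝ (classically, or
-- constructively with its apartness relation) and ℚ are both instances.
record CharZeroField (a ℓ₁ ℓ₂ : Level) : Set (lsuc (a ⊔ ℓ₁ ⊔ ℓ₂)) where
  field
    heytingField : HeytingField a ℓ₁ ℓ₂

  open HeytingField heytingField public

  commutativeRing : CommutativeRing a ℓ₁
  commutativeRing = HeytingCommutativeRing.commutativeRing heytingCommutativeRing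

  open CommutativeRing commutativeRing public using (+-rawMonoid)
  open RawMonoidDefs +-rawMonoid public using (sum) renaming (_×_ to _·_)

  fromℕ : ℕ → Carrier
  fromℕ m = m · 1#

  field
    charZero : ∀ m → .{{NonZero m}} → fromℕ m # 0#

  -- `#⇒invertible` yields an inverse of fromℕ m - 0#.
  1/ℕ_ : (m : ℕ) → .{{NonZero m}} → Carrier
  1/ℕ m = proj₁ (#⇒invertible (charZero m))

module _ {a ℓ₁ ℓ₂ : Level} (F : CharZeroField a ℓ₁ ℓ₂) where

  open CharZeroField F renaming (_*_ to _*ᶠ_)

  Matrix : ℕ → Set a
  Matrix n = Fin n → Fin n → Carrier

  diagonal : {n : ℕ} → (Fin n → Carrier) → Matrix n
  diagonal d v w with v Fin.≟ w
  ... | yes _ = d v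
  ... | no  _ = 0#

  identity : {n : ℕ} → Matrix n
  identity = diagonal (λ _ → 1#)

  matMul : {n : ℕ} → Matrix n → Matrix n → Matrix n
  matMul M N v w = sum (λ u → M v u *ᶠ N u w)

  matApply : {n : ℕ} → Matrix n → (Fin n → Carrier) → (Fin n → Carrier)
  matApply M f v = sum (λ w → M v w *ᶠ f w)

  EigenfunctionWith : {n : ℕ} → Matrix n → Carrier → (Fin n → Carrier) → Set ℓ₁
  EigenfunctionWith M μ f =
    ¬ (∀ v → f v ≈ 0#) × (∀ v → matApply M f v ≈ μ *ᶠ f v)

  Eigenfunction : {n : ℕ} → Matrix n → (Fin n → Carrier) → Set (a ⊔ ℓ₁)
  Eigenfunction M f = ∃[ μ ] EigenfunctionWith M μ f

  adjacency : {n : ℕ} → Hypergraph n → Matrix n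
  adjacency Γ v w with v Fin.≟ w
  ... | yes _ = 0#
  ... | no  _ = - fromℕ (codegree Γ v w)

  inverseDegree : {n : ℕ} (Γ : Hypergraph n) → NoIsolatedVertices Γ → Matrix n
  inverseDegree Γ noIso = diagonal (λ v → 1/ℕ_ (degree Γ v) {{>-nonZero (noIso v)}})

  laplacian : {n : ℕ} (Γ : Hypergraph n) → NoIsolatedVertices Γ → Matrix n
  laplacian Γ noIso v w =
    identity v w - matMul (inverseDegree Γ noIso) (adjacency Γ) v w

  -- Intended for i ≢ j, when the two colour classes are disjoint.
  colorDifference : {n k : ℕ} → (Fin n → Fin k) → Fin k → Fin k → (Fin n → Carrier)
  colorDifference κ i j w with w ∈? colorClass κ i | w ∈? colorClass κ j
  ... | yes _ | _     = 1#
  ... | no  _ | yes _ = - 1#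
  ... | no  _ | no  _ = 0#

  colorEigenvalue : (c k : ℕ) → 2 ≤ k → Carrier
  colorEigenvalue c k 2≤k =
    (fromℕ k - fromℕ c) *ᶠ 1/ℕ_ (k ∸ 1) {{2≤⇒nonZero-pred 2≤k}}

{-# OPTIONS --safe #-}
module Submission where

-- An edge meets each color class at most once, so with Aᵢ(v) the number of
-- edges through v meeting Vᵢ and Bᵢ(v) equal to Aᵢ(v) off Vᵢ and to 0 on Vᵢ,
--   L gᵢⱼ(v) = gᵢⱼ(v) + (Bᵢ(v) - Bⱼ(v)) / deg v.
-- If the gᵢⱼ are eigenfunctions, then Aᵢ(v) = Aⱼ(v) for any two classes not
-- containing v; double counting gives Σᵢ Aᵢ(v) = c deg v, where v's own class
-- contributes deg v, so the other k - 1 share (c - 1) deg v equally.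
-- Conversely, if they do, then Bᵢ(v) / deg v = s (1 - χᵢ(v)) with
-- s = (c - 1) / (k - 1), whence L gᵢⱼ = (1 - s) gᵢⱼ; moreover no class is
-- empty, so gᵢⱼ takes the value 1.

open import Defs
open import Algebra.Bundles using (CommutativeMonoid; CommutativeRing)
import Algebra.Properties.AbelianGroup as AbelianGroupProperties
import Algebra.Properties.CommutativeMonoid.Sum as CommutativeMonoidSum
import Algebra.Properties.CommutativeSemigroup as CommutativeSemigroupProperties
import Algebra.Properties.Ring as RingProperties
import Algebra.Properties.Semiring.Mult as SemiringMult
import Algebra.Properties.Semiring.Sum as SemiringSum
open import Data.Bool.Base using (if_then_else_)
open import Data.Fin.Base using (Fin; zero; suc; punchIn)
import Data.Fin.Properties as Fin
open import Data.Fin.Subset using (Subset; Nonempty; inside; outside; _∈_; _∩_; ∣_∣)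
open import Data.Fin.Subset.Properties using (_∈?_; nonempty?; x∈p∩q⁺; x∈p∩q⁻)
open import Data.Integer.Base using (+_)
import Data.Integer.Properties as ℤ
open import Data.List.Base using (List; []; _∷_; length; filter)
open import Data.List.Properties using (filter-≐; filter-none)
open import Data.List.Relation.Unary.All as All using (All; []; _∷_)
open import Data.Nat.Base as ℕ using (ℕ; _≤_; _<_; _∸_; NonZero; >-nonZero; s≤s)
import Data.Nat.Properties as ℕ
open import Data.Product.Base using (_×_; _,_; proj₁; proj₂; ∃-syntax)
open import Data.Rational.Base using (_/_)
open import Data.Rational.Properties using (/-injective-≃; fromℚᵘ-cong)
open import Data.Rational.Unnormalised.Base using (mkℚᵘ; *≡*)
open import Data.Vec.Base using ([]; _∷_)
open import Data.Vec.Properties using (lookup∘tabulate; lookup⇒[]=; []=⇒lookup)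
open import Function.Base using (_∘_)
open import Function.Bundles using (_⇔_; mk⇔; Equivalence)
open import Level using (Level)
open import Relation.Binary.Definitions using (tri<; tri≈; tri>)
open import Relation.Binary.PropositionalEquality.Core as ≡ using (_≡_; _≢_)
open import Relation.Binary.PropositionalEquality.Properties using (module ≡-Reasoning)
import Relation.Binary.Reasoning.Setoid as SetoidReasoning
open import Relation.Nullary.Decidable using (Dec; does; yes; no; _×-dec_; dec-true; dec-false; decidable-stable)
open import Relation.Nullary.Negation.Core using (¬_; contradiction)
open import Relation.Unary using (Pred; Decidable)

private variable
  ℓP ℓQ : Level
  P : Set ℓP
  Q : Set ℓQ

-- Finite sums with at most one nonzero term.

module _ {a ℓ} (M : CommutativeMonoid a ℓ) where
  open CommutativeMonoid M
  open CommutativeMonoidSum M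

  sum-zero : ∀ {n} {t : Fin n → Carrier} → (∀ u → t u ≈ ε) → sum t ≈ ε
  sum-zero {n} t≈ε = trans (sum-cong-≋ t≈ε) (sum-replicate-zero n)

  sum-single : ∀ {n} {t : Fin n → Carrier} v → (∀ u → u ≢ v → t u ≈ ε) → sum t ≈ t v
  sum-single {ℕ.suc n} {t} v t≈ε = trans (sum-remove {i = v} t)
    (trans (∙-congˡ (sum-zero (λ u → t≈ε (punchIn v u) (Fin.punchInᵢ≢i v u)))) (identityʳ _))

-- Counting

module ∑ = SemiringSum ℕ.+-*-semiring
open ∑ using (sum)

indicator : Dec P → ℕ
indicator P? = if does P? then 1 else 0

indicator-true : (P? : Dec P) → P → indicator P? ≡ 1
indicator-true P? p = ≡.cong (if_then 1 else 0) (dec-true P? p)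

indicator-false : (P? : Dec P) → ¬ P → indicator P? ≡ 0
indicator-false P? ¬p = ≡.cong (if_then 1 else 0) (dec-false P? ¬p)

indicator-⇔ : (P? : Dec P) (Q? : Dec Q) → (P → Q) → (Q → P) → indicator P? ≡ indicator Q?
indicator-⇔ (yes p) Q? P⇒Q Q⇒P = ≡.sym (indicator-true Q? (P⇒Q p))
indicator-⇔ (no ¬p) Q? P⇒Q Q⇒P = ≡.sym (indicator-false Q? (¬p ∘ Q⇒P))

indicator-× : (P? : Dec P) (Q? : Dec Q) → indicator (P? ×-dec Q?) ≡ indicator P? ℕ.* indicator Q?
indicator-× (yes _) Q? = ≡.sym (ℕ.+-identityʳ _)
indicator-× (no _)  Q? = ≡.refl

length-filter-∷ : ∀ {A : Set} {P : Pred A ℓP} (P? : Decidable P) x xs →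
  length (filter P? (x ∷ xs)) ≡ indicator (P? x) ℕ.+ length (filter P? xs)
length-filter-∷ P? x xs with P? x
... | yes _ = ≡.refl
... | no  _ = ≡.refl

-- At most one term equals 1, so the sum is again an indicator. This serves both for the color of a
-- vertex and for the vertex of a given color in an edge.
sum-indicator : ∀ {n} {P : Pred (Fin n) ℓP} (P? : Decidable P) →
  (∀ x y → P x → P y → x ≡ y) → sum (λ x → indicator (P? x)) ≡ indicator (Fin.any? P?)
sum-indicator P? unique with Fin.any? P?
... | yes (x , Px) = ≡.trans
  (sum-single ℕ.+-0-commutativeMonoid x λ y y≢x → indicator-false (P? y) λ Py → y≢x (unique y x Py Px))
  (indicator-true (P? x) Px)
... | no ¬∃P = sum-zero ℕ.+-0-commutativeMonoid λ x → indicator-false (P? x) λ Px → ¬∃P (x , Px)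

card-sum : ∀ {n} (S : Subset n) → sum (λ w → indicator (w ∈? S)) ≡ ∣ S ∣
card-sum []            = ≡.refl
card-sum (inside  ∷ S) = ≡.cong ℕ.suc (card-sum S)
card-sum (outside ∷ S) = card-sum S

sum-const : ∀ n x → sum {n} (λ _ → x) ≡ n ℕ.* x
sum-const ℕ.zero    x = ≡.refl
sum-const (ℕ.suc n) x = ≡.cong (x ℕ.+_) (sum-const n x)

sum-remove-const : ∀ {n} (t : Fin (ℕ.suc n) → ℕ) l {x} → (∀ j → j ≢ l → t j ≡ x) →
  sum t ≡ t l ℕ.+ n ℕ.* x
sum-remove-const {n} t l t≡x = ≡.trans (∑.sum-remove {i = l} t)
  (≡.cong (t l ℕ.+_) (≡.trans (∑.sum-cong-≗ λ j → t≡x (punchIn l j) (Fin.punchInᵢ≢i l j)) (sum-const n _)))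

-- Cross-multiplication, carried out on unnormalised fractions; it moves the counting condition from
-- ℚ to ℕ.
/1≡/⇔ : ∀ m n d → ((+ m) / 1 ≡ (+ n) / ℕ.suc d) ⇔ (m ℕ.* ℕ.suc d ≡ n)
/1≡/⇔ m n d = mk⇔ to from
  where
  to : (+ m) / 1 ≡ (+ n) / ℕ.suc d → m ℕ.* ℕ.suc d ≡ n
  to eq with /-injective-≃ (mkℚᵘ (+ m) 0) (mkℚᵘ (+ n) d) eq
  ... | *≡* eq′ = ℤ.+-injective (≡.trans (ℤ.pos-* m (ℕ.suc d)) (≡.trans eq′ (ℤ.*-identityʳ (+ n))))
  from : m ℕ.* ℕ.suc d ≡ n → (+ m) / 1 ≡ (+ n) / ℕ.suc d
  from ≡.refl = fromℚᵘ-cong {mkℚᵘ (+ m) 0} {mkℚᵘ (+ n) d}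
    (*≡* (≡.trans (≡.sym (ℤ.pos-* m (ℕ.suc d))) (≡.sym (ℤ.*-identityʳ _))))

-- Color classes

module _ {n k} (κ : Fin n → Fin k) where

  ∈colorClass⁺ : ∀ {i v} → κ v ≡ i → v ∈ colorClass κ i
  ∈colorClass⁺ {i} {v} κv≡i =
    lookup⇒[]= v _ (≡.trans (lookup∘tabulate _ v) (dec-true (κ v Fin.≟ i) κv≡i))

  ∈colorClass⁻ : ∀ {i v} → v ∈ colorClass κ i → κ v ≡ i
  -- The membership equation is abstracted together with the decision, so that in the `no` case it
  -- reduces to an absurd equation of booleans.
  ∈colorClass⁻ {i} {v} v∈Vᵢ with κ v Fin.≟ i | ≡.trans (≡.sym (lookup∘tabulate (λ w → does (κ w Fin.≟ i)) v)) ([]=⇒lookup v∈Vᵢ)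
  ... | yes κv≡i | _ = κv≡i
  ... | no _     | ()

  χ : Fin k → Fin n → ℕ
  χ i w = indicator (κ w Fin.≟ i)

  sum-χ : ∀ w → sum (λ i → χ i w) ≡ 1
  sum-χ w = ≡.trans (sum-indicator (κ w Fin.≟_) λ _ _ eq eq′ → ≡.trans (≡.sym eq) eq′)
    (indicator-true (Fin.any? (κ w Fin.≟_)) (κ w , ≡.refl))

-- Double counting of incidences.

module _ {n} (Γ : Hypergraph n) where

  -- Both sides count pairs of an edge `e` through `v` and a vertex `w` of `e`: each such edge has
  -- `c` vertices, `w = v` included. The induction is on the list of edges.
  sum-codegree : ∀ {c} → Uniform Γ c → ∀ v → sum (codegree Γ v) ≡ c ℕ.* degree Γ v
  sum-codegree {c} uniform v = go (edges Γ) uniform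
    where
    go : ∀ es → All (λ e → ∣ e ∣ ≡ c) es →
      sum (λ w → length (filter (λ e → (v ∈? e) ×-dec (w ∈? e)) es)) ≡ c ℕ.* length (filter (v ∈?_) es)
    go []       _              = ≡.trans (sum-zero ℕ.+-0-commutativeMonoid λ (_ : Fin n) → ≡.refl) (≡.sym (ℕ.*-zeroʳ c))
    go (e ∷ es) (∣e∣≡c ∷ rest) = begin
      sum (λ w → length (filter (λ e → (v ∈? e) ×-dec (w ∈? e)) (e ∷ es)))
        ≡⟨ ∑.sum-cong-≗ (λ w → ≡.trans (length-filter-∷ (λ e → (v ∈? e) ×-dec (w ∈? e)) e es)
             (≡.cong (ℕ._+ _) (indicator-× (v ∈? e) (w ∈? e)))) ⟩
      sum (λ w → ⟦v∈e⟧ ℕ.* indicator (w ∈? e) ℕ.+ length (filter (λ e → (v ∈? e) ×-dec (w ∈? e)) es))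
        ≡⟨ ∑.∑-distrib-+ (λ w → ⟦v∈e⟧ ℕ.* indicator (w ∈? e)) _ ⟩
      sum (λ w → ⟦v∈e⟧ ℕ.* indicator (w ∈? e)) ℕ.+ _
        ≡⟨ ≡.cong₂ ℕ._+_ (∑.*-distribˡ-sum ⟦v∈e⟧ (λ w → indicator (w ∈? e))) (≡.sym (go es rest)) ⟨
      ⟦v∈e⟧ ℕ.* sum (λ w → indicator (w ∈? e)) ℕ.+ c ℕ.* d
        ≡⟨ ≡.cong (λ x → ⟦v∈e⟧ ℕ.* x ℕ.+ c ℕ.* d) (≡.trans (card-sum e) ∣e∣≡c) ⟩
      ⟦v∈e⟧ ℕ.* c ℕ.+ c ℕ.* d
        ≡⟨ ≡.cong (ℕ._+ c ℕ.* d) (ℕ.*-comm ⟦v∈e⟧ c) ⟩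
      c ℕ.* ⟦v∈e⟧ ℕ.+ c ℕ.* d
        ≡⟨ ℕ.*-distribˡ-+ c ⟦v∈e⟧ d ⟨
      c ℕ.* (⟦v∈e⟧ ℕ.+ d)
        ≡⟨ ≡.cong (c ℕ.*_) (length-filter-∷ (v ∈?_) e es) ⟨
      c ℕ.* length (filter (v ∈?_) (e ∷ es)) ∎
      where
      open ≡-Reasoning
      ⟦v∈e⟧ = indicator (v ∈? e)
      d = length (filter (v ∈?_) es)

  -- The negated adjacency matrix, with entries kept in ℕ so that the combinatorics can be done
  -- before passing to the field.
  codegree-off-diagonal : Fin n → Fin n → ℕ
  codegree-off-diagonal v w with v Fin.≟ w
  ... | yes _ = 0
  ... | no  _ = codegree Γ v w

  module _ {k} (κ : Fin n → Fin k) (proper : ProperStrongColoring Γ κ) where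

    private
      Injective-on : Subset n → Set
      Injective-on e = ∀ v w → v ∈ e → w ∈ e → κ v ≡ κ w → v ≡ w

      -- Properness contraposed; decidable equality of vertices removes the double negation.
      injective : All Injective-on (edges Γ)
      injective = All.map (λ distinct v w v∈e w∈e κv≡κw →
        decidable-stable (v Fin.≟ w) λ v≢w → distinct v w v∈e w∈e v≢w κv≡κw) proper

    -- An edge meets a color class in at most one vertex, so that counting
    -- edges through v and Vᵢ amounts to counting pairs (edge, vertex of Vᵢ).
    sum-codegree-χ : ∀ i v → sum (λ w → codegree Γ v w ℕ.* χ κ i w) ≡ edgesMeeting Γ v (colorClass κ i)
    sum-codegree-χ i v = go (edges Γ) injective
      where
      through : List (Subset n) → Fin n → ℕ
      through es w = length (filter (λ e → (v ∈? e) ×-dec (w ∈? e)) es)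

      meets? : ∀ e → Dec (v ∈ e × Nonempty (e ∩ colorClass κ i))
      meets? e = (v ∈? e) ×-dec nonempty? (e ∩ colorClass κ i)

      head-term : ∀ e → Injective-on e →
        sum (λ w → indicator ((v ∈? e) ×-dec (w ∈? e)) ℕ.* χ κ i w) ≡ indicator (meets? e)
      head-term e inj = begin
        sum (λ w → indicator ((v ∈? e) ×-dec (w ∈? e)) ℕ.* χ κ i w)
          ≡⟨ ∑.sum-cong-≗ (λ w → ≡.trans (≡.cong (ℕ._* χ κ i w) (indicator-× (v ∈? e) (w ∈? e)))
               (≡.trans (ℕ.*-assoc (indicator (v ∈? e)) (indicator (w ∈? e)) (χ κ i w))
                 (≡.cong (indicator (v ∈? e) ℕ.*_) (∩-indicator w)))) ⟩
        sum (λ w → indicator (v ∈? e) ℕ.* indicator (w ∈? (e ∩ colorClass κ i)))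
          ≡⟨ ∑.*-distribˡ-sum (indicator (v ∈? e)) (λ w → indicator (w ∈? (e ∩ colorClass κ i))) ⟨
        indicator (v ∈? e) ℕ.* sum (λ w → indicator (w ∈? (e ∩ colorClass κ i)))
          ≡⟨ ≡.cong (indicator (v ∈? e) ℕ.*_) (sum-indicator (_∈? (e ∩ colorClass κ i)) at-most-one) ⟩
        indicator (v ∈? e) ℕ.* indicator (nonempty? (e ∩ colorClass κ i))
          ≡⟨ indicator-× (v ∈? e) (nonempty? (e ∩ colorClass κ i)) ⟨
        indicator (meets? e) ∎
        where
        open ≡-Reasoning
        ∩-indicator : ∀ w → indicator (w ∈? e) ℕ.* χ κ i w ≡ indicator (w ∈? (e ∩ colorClass κ i))
        ∩-indicator w = ≡.trans (≡.sym (indicator-× (w ∈? e) (κ w Fin.≟ i)))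
          (indicator-⇔ ((w ∈? e) ×-dec (κ w Fin.≟ i)) (w ∈? (e ∩ colorClass κ i))
            (λ (w∈e , κw≡i) → x∈p∩q⁺ (w∈e , ∈colorClass⁺ κ κw≡i))
            (λ w∈∩ → let (w∈e , w∈Vᵢ) = x∈p∩q⁻ e (colorClass κ i) w∈∩ in w∈e , ∈colorClass⁻ κ w∈Vᵢ))
        at-most-one : ∀ x y → x ∈ e ∩ colorClass κ i → y ∈ e ∩ colorClass κ i → x ≡ y
        at-most-one x y x∈ y∈ with x∈p∩q⁻ e (colorClass κ i) x∈ | x∈p∩q⁻ e (colorClass κ i) y∈
        ... | x∈e , x∈Vᵢ | y∈e , y∈Vᵢ =
          inj x y x∈e y∈e (≡.trans (∈colorClass⁻ κ x∈Vᵢ) (≡.sym (∈colorClass⁻ κ y∈Vᵢ)))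

      go : ∀ es → All Injective-on es →
        sum (λ w → through es w ℕ.* χ κ i w) ≡ length (filter meets? es)
      go []       _            = sum-zero ℕ.+-0-commutativeMonoid {t = λ (_ : Fin n) → 0} λ _ → ≡.refl
      go (e ∷ es) (inj ∷ rest) = begin
        sum (λ w → through (e ∷ es) w ℕ.* χ κ i w)
          ≡⟨ ∑.sum-cong-≗ (λ w → ≡.trans
               (≡.cong (ℕ._* χ κ i w) (length-filter-∷ (λ e → (v ∈? e) ×-dec (w ∈? e)) e es))
               (ℕ.*-distribʳ-+ (χ κ i w) (indicator ((v ∈? e) ×-dec (w ∈? e))) (through es w))) ⟩
        sum (λ w → indicator ((v ∈? e) ×-dec (w ∈? e)) ℕ.* χ κ i w ℕ.+ through es w ℕ.* χ κ i w)
          ≡⟨ ∑.∑-distrib-+ (λ w → indicator ((v ∈? e) ×-dec (w ∈? e)) ℕ.* χ κ i w) _ ⟩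
        sum (λ w → indicator ((v ∈? e) ×-dec (w ∈? e)) ℕ.* χ κ i w) ℕ.+ sum (λ w → through es w ℕ.* χ κ i w)
          ≡⟨ ≡.cong₂ ℕ._+_ (head-term e inj) (go es rest) ⟩
        indicator (meets? e) ℕ.+ length (filter meets? es)
          ≡⟨ length-filter-∷ meets? e es ⟨
        length (filter meets? (e ∷ es)) ∎
        where open ≡-Reasoning

    codegree-monochromatic : ∀ {v w} → v ≢ w → κ v ≡ κ w → codegree Γ v w ≡ 0
    codegree-monochromatic {v} {w} v≢w κv≡κw = ≡.cong length
      (filter-none (λ e → (v ∈? e) ×-dec (w ∈? e))
        (All.map (λ inj (v∈e , w∈e) → v≢w (inj v w v∈e w∈e κv≡κw)) injective))

    -- Every edge through `v` meets the class of `v` in `v` itself. This is the second half of the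
    -- counting condition.
    edgesMeeting-own-class : ∀ {i v} → κ v ≡ i → edgesMeeting Γ v (colorClass κ i) ≡ degree Γ v
    edgesMeeting-own-class {i} {v} κv≡i = ≡.cong length (filter-≐ _ (v ∈?_)
      (proj₁ , (λ v∈e → v∈e , v , x∈p∩q⁺ (v∈e , ∈colorClass⁺ κ κv≡i))) (edges Γ))

    -- After exchanging the sums, each vertex `w` is counted for exactly one color, which leaves the
    -- total of the codegrees.
    sum-edgesMeeting : ∀ {c} → Uniform Γ c → ∀ v →
      sum (λ i → edgesMeeting Γ v (colorClass κ i)) ≡ c ℕ.* degree Γ v
    sum-edgesMeeting {c} uniform v = begin
      sum (λ i → edgesMeeting Γ v (colorClass κ i))
        ≡⟨ ∑.sum-cong-≗ (λ i → sum-codegree-χ i v) ⟨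
      sum (λ i → sum (λ w → codegree Γ v w ℕ.* χ κ i w))
        ≡⟨ ∑.∑-comm (λ i w → codegree Γ v w ℕ.* χ κ i w) ⟩
      sum (λ w → sum (λ i → codegree Γ v w ℕ.* χ κ i w))
        ≡⟨ ∑.sum-cong-≗ (λ w → ≡.trans (≡.sym (∑.*-distribˡ-sum (codegree Γ v w) (λ i → χ κ i w)))
             (≡.trans (≡.cong (codegree Γ v w ℕ.*_) (sum-χ κ w)) (ℕ.*-identityʳ _))) ⟩
      sum (codegree Γ v)
        ≡⟨ sum-codegree uniform v ⟩
      c ℕ.* degree Γ v ∎
      where open ≡-Reasoning

    -- This is `Bᵢ(v)`, written as the negated adjacency matrix applied to the indicator of `Vᵢ`,
    -- the form in which it arises from the Laplacian.
    neighbours : Fin k → Fin n → ℕ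
    neighbours i v = sum (λ w → codegree-off-diagonal v w ℕ.* χ κ i w)

    -- The term `w = v` is zero on the diagonal, any other `w` of the same color shares no edge with
    -- `v`, and the remaining `w` lie outside `Vᵢ`.
    neighbours-own-class : ∀ {i v} → κ v ≡ i → neighbours i v ≡ 0
    neighbours-own-class {i} {v} κv≡i = sum-zero ℕ.+-0-commutativeMonoid vanish
      where
      vanish : ∀ w → codegree-off-diagonal v w ℕ.* χ κ i w ≡ 0
      vanish w with v Fin.≟ w
      ... | yes _ = ≡.refl
      ... | no v≢w with κ w Fin.≟ i
      ...   | yes κw≡i = ≡.cong (ℕ._* 1) (codegree-monochromatic v≢w (≡.trans κv≡i (≡.sym κw≡i)))
      ...   | no _     = ℕ.*-zeroʳ (codegree Γ v w)

    -- Here `v` lies outside `Vᵢ`, so erasing the diagonal entry changes nothing in the sum.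
    neighbours-other-class : ∀ {i v} → κ v ≢ i → neighbours i v ≡ edgesMeeting Γ v (colorClass κ i)
    neighbours-other-class {i} {v} κv≢i = ≡.trans (∑.sum-cong-≗ agree) (sum-codegree-χ i v)
      where
      agree : ∀ w → codegree-off-diagonal v w ℕ.* χ κ i w ≡ codegree Γ v w ℕ.* χ κ i w
      agree w with v Fin.≟ w
      ... | yes ≡.refl = ≡.sym (≡.trans (≡.cong (codegree Γ v v ℕ.*_) (indicator-false (κ v Fin.≟ i) κv≢i))
                           (ℕ.*-zeroʳ (codegree Γ v v)))
      ... | no _       = ≡.refl

-- The counting condition as an equation of natural numbers.

Equidistributed : ∀ {n} → Hypergraph n → ℕ → ∀ {k} → (Fin n → Fin k) → Set
Equidistributed Γ c {k} κ = ∀ i v → κ v ≢ i →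
  edgesMeeting Γ v (colorClass κ i) ℕ.* (k ∸ 1) ≡ (c ∸ 1) ℕ.* degree Γ v

module _ {n} (Γ : Hypergraph n) (c : ℕ) where

  counting⇒equidistributed : ∀ {k} (2≤k : 2 ≤ k) (κ : Fin n → Fin k) →
    CountingCondition Γ c 2≤k κ → Equidistributed Γ c κ
  -- Matching twice exposes `k ∸ 1` as a successor, the shape of the denominator in `/1≡/⇔`.
  counting⇒equidistributed (s≤s (s≤s _)) κ counting i v κv≢i =
    Equivalence.to (/1≡/⇔ (edgesMeeting Γ v (colorClass κ i)) _ _) (proj₁ (counting i v) (κv≢i ∘ ∈colorClass⁻ κ))

  equidistributed⇒counting : ∀ {k} (2≤k : 2 ≤ k) (κ : Fin n → Fin k) → ProperStrongColoring Γ κ →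
    Equidistributed Γ c κ → CountingCondition Γ c 2≤k κ
  equidistributed⇒counting (s≤s (s≤s _)) κ proper equi i v =
      (λ v∉Vᵢ → Equivalence.from (/1≡/⇔ (edgesMeeting Γ v (colorClass κ i)) _ _) (equi i v (v∉Vᵢ ∘ ∈colorClass⁺ κ)))
    , (λ v∈Vᵢ → edgesMeeting-own-class Γ κ proper (∈colorClass⁻ κ v∈Vᵢ))

-- Two evaluations of the sum of all `Aⱼ(v)` are compared: `c deg v` by double counting, and `deg v`
-- plus `k - 1` equal terms by hypothesis.
constant-off-own-class⇒equidistributed :
  ∀ {n} (Γ : Hypergraph n) {c k} → 2 ≤ c → 2 ≤ k → (κ : Fin n → Fin k) →
  Uniform Γ c → ProperStrongColoring Γ κ →
  (∀ i j v → i ≢ j → κ v ≢ i → κ v ≢ j →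
    edgesMeeting Γ v (colorClass κ i) ≡ edgesMeeting Γ v (colorClass κ j)) →
  Equidistributed Γ c κ
constant-off-own-class⇒equidistributed Γ {k = k} (s≤s {n = c-1} _) (s≤s {n = k-1} _) κ uniform proper constant i v κv≢i =
  ℕ.+-cancelˡ-≡ d _ _ (begin
    d ℕ.+ A i ℕ.* k-1        ≡⟨ ≡.cong (d ℕ.+_) (ℕ.*-comm (A i) k-1) ⟩
    d ℕ.+ k-1 ℕ.* A i        ≡⟨ ≡.cong (ℕ._+ k-1 ℕ.* A i) (edgesMeeting-own-class Γ κ proper ≡.refl) ⟨
    A (κ v) ℕ.+ k-1 ℕ.* A i  ≡⟨ sum-remove-const A (κ v) same ⟨
    -- With `c` matched as `suc c-1`, the product `c * d` computes to `d + c-1 * d`, so `d` can be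
    -- cancelled without subtraction.
    sum A                    ≡⟨ sum-edgesMeeting Γ κ proper uniform v ⟩
    d ℕ.+ c-1 ℕ.* d          ∎)
  where
  open ≡-Reasoning
  d = degree Γ v
  A : Fin k → ℕ
  A j = edgesMeeting Γ v (colorClass κ j)
  same : ∀ j → j ≢ κ v → A j ≡ A i
  -- The hypothesis compares distinct colors only, so `j = i` is split off.
  same j j≢κv with j Fin.≟ i
  ... | yes ≡.refl = ≡.refl
  ... | no j≢i     = constant j i v j≢i (j≢κv ∘ ≡.sym) κv≢i

-- If color `i` were missing, no edge would meet its class, and the equation at vertex `zero` would
-- give `(c - 1) deg zero = 0`, although both factors are positive.
equidistributed⇒surjective :
  ∀ {n} (Γ : Hypergraph n) {c k} → 2 ≤ c → (κ : Fin n → Fin k) →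
  1 ≤ n → NoIsolatedVertices Γ → Equidistributed Γ c κ → ∀ i → ∃[ v ] κ v ≡ i
equidistributed⇒surjective Γ {c} {k} 2≤c κ (s≤s _) noIso equi i with Fin.any? (λ v → κ v Fin.≟ i)
... | yes found   = found
... | no  missing = contradiction zero-product (ℕ.>⇒≢ (ℕ.*-mono-< (ℕ.∸-monoˡ-≤ 1 2≤c) (noIso zero)))
  where
  no-edges : edgesMeeting Γ zero (colorClass κ i) ≡ 0
  no-edges = ≡.cong length (filter-none (λ e → (zero ∈? e) ×-dec nonempty? (e ∩ colorClass κ i))
    {edges Γ} (All.tabulate λ {e} _ (_ , w , w∈) →
      missing (w , ∈colorClass⁻ κ (proj₂ (x∈p∩q⁻ e (colorClass κ i) w∈)))))
  zero-product : (c ∸ 1) ℕ.* degree Γ zero ≡ 0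
  zero-product = ≡.trans (≡.sym (equi i zero λ κ0≡i → missing (zero , κ0≡i))) (≡.cong (ℕ._* (k ∸ 1)) no-edges)

-- The Laplacian

module _ {a ℓ₁ ℓ₂} (F : CharZeroField a ℓ₁ ℓ₂) where

  open CharZeroField F using (fromℕ; 1/ℕ_; charZero; #-irrefl; #⇒invertible; commutativeRing)
  open CommutativeRing commutativeRing hiding (zero)
  open AbelianGroupProperties +-abelianGroup using (x∙y⁻¹≈ε⇒x≈y; ⁻¹-∙-comm)
    renaming (ε⁻¹≈ε to -0≈0)
  open RingProperties ring using (-‿distribʳ-*; -‿involutive; [y-z]x≈yx-zx; x[y-z]≈xy-xz)
  open SemiringMult semiring using (×1-homo-*; ×-homo-+; ×-homo-1; ×-congˡ)
  open CommutativeSemigroupProperties +-commutativeSemigroup using (interchange)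
  module ∑ᶠ = SemiringSum semiring
  open SetoidReasoning setoid

  -- Natural numbers inside the field.

  fromℕ-cong : ∀ {m n} → m ≡ n → fromℕ m ≈ fromℕ n
  fromℕ-cong = ×-congˡ

  fromℕ-sum : ∀ {n} (t : Fin n → ℕ) → fromℕ (sum t) ≈ ∑ᶠ.sum (fromℕ ∘ t)
  fromℕ-sum {ℕ.zero}  t = refl
  fromℕ-sum {ℕ.suc n} t = trans (×-homo-+ 1# (t zero) _) (+-congˡ (fromℕ-sum (t ∘ suc)))

  fromℕ≉0 : ∀ m → .{{NonZero m}} → ¬ fromℕ m ≈ 0#
  fromℕ≉0 m m≈0 = #-irrefl m≈0 (charZero m)

  1≉0 : ¬ 1# ≈ 0#
  1≉0 1≈0 = fromℕ≉0 1 (trans (×-homo-1 1#) 1≈0)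

  -- Characteristic zero is applied to the gap `n ∸ m`, whose image is the difference of the two
  -- images.
  fromℕ-<⇒≉ : ∀ {m n} → m < n → ¬ fromℕ m ≈ fromℕ n
  fromℕ-<⇒≉ {m} {n} m<n m≈n = fromℕ≉0 (n ∸ m) {{>-nonZero (ℕ.m<n⇒0<n∸m m<n)}} (begin
    fromℕ (n ∸ m)                            ≈⟨ +-identityʳ _ ⟨
    fromℕ (n ∸ m) + 0#                       ≈⟨ +-congˡ (-‿inverseʳ (fromℕ m)) ⟨
    fromℕ (n ∸ m) + (fromℕ m - fromℕ m)      ≈⟨ +-assoc _ _ _ ⟨
    fromℕ (n ∸ m) + fromℕ m - fromℕ m        ≈⟨ +-congʳ (×-homo-+ 1# (n ∸ m) m) ⟨
    fromℕ (n ∸ m ℕ.+ m) - fromℕ m            ≈⟨ +-congʳ (fromℕ-cong (ℕ.m∸n+n≡m (ℕ.<⇒≤ m<n))) ⟩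
    fromℕ n - fromℕ m                        ≈⟨ +-congʳ m≈n ⟨
    fromℕ m - fromℕ m                        ≈⟨ -‿inverseʳ (fromℕ m) ⟩
    0#                                       ∎)

  -- The comparison is decided in ℕ, as equality in the field need not be decidable. This carries
  -- equations between counts back from the field.
  fromℕ-injective : ∀ {m n} → fromℕ m ≈ fromℕ n → m ≡ n
  fromℕ-injective {m} {n} m≈n with ℕ.<-cmp m n
  ... | tri< m<n _ _ = contradiction m≈n (fromℕ-<⇒≉ m<n)
  ... | tri≈ _ m≡n _ = m≡n
  ... | tri> _ _ n<m = contradiction (sym m≈n) (fromℕ-<⇒≉ n<m)

  fromℕ-*-1/ℕ : ∀ m .{{_ : NonZero m}} → fromℕ m * 1/ℕ m ≈ 1#
  fromℕ-*-1/ℕ m = begin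
    fromℕ m * 1/ℕ m          ≈⟨ *-congʳ (trans (+-congˡ -0≈0) (+-identityʳ _)) ⟨
    (fromℕ m - 0#) * 1/ℕ m   ≈⟨ proj₂ (proj₂ (#⇒invertible (charZero m))) ⟩
    1#                       ∎

  sum-diagonal : ∀ {n} (d x : Fin n → Carrier) v → ∑ᶠ.sum (λ u → diagonal F d v u * x u) ≈ d v * x v
  sum-diagonal d x v = trans (sum-single +-commutativeMonoid v off) on
    where
    off : ∀ u → u ≢ v → diagonal F d v u * x u ≈ 0#
    off u u≢v with v Fin.≟ u
    ... | yes v≡u = contradiction (≡.sym v≡u) u≢v
    ... | no _    = zeroˡ (x u)
    on : diagonal F d v v * x v ≈ d v * x v
    on with v Fin.≟ v
    ... | yes _   = refl
    ... | no v≢v = contradiction ≡.refl v≢v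

  sum-distrib-- : ∀ {n} (s t : Fin n → Carrier) → ∑ᶠ.sum (λ u → s u - t u) ≈ ∑ᶠ.sum s - ∑ᶠ.sum t
  sum-distrib-- {ℕ.zero}  s t = sym (-‿inverseʳ 0#)
  sum-distrib-- {ℕ.suc n} s t = begin
    s zero - t zero + ∑ᶠ.sum (λ u → s (suc u) - t (suc u))
      ≈⟨ +-congˡ (sum-distrib-- (s ∘ suc) (t ∘ suc)) ⟩
    s zero - t zero + (∑ᶠ.sum (s ∘ suc) - ∑ᶠ.sum (t ∘ suc))
      ≈⟨ interchange _ _ _ _ ⟩
    s zero + ∑ᶠ.sum (s ∘ suc) + (- t zero - ∑ᶠ.sum (t ∘ suc))
      ≈⟨ +-congˡ (⁻¹-∙-comm _ _) ⟩
    ∑ᶠ.sum s - ∑ᶠ.sum t ∎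

  -- The action of the Laplacian on a function.

  module _ {n} (Γ : Hypergraph n) (noIso : NoIsolatedVertices Γ) where

    1/deg : Fin n → Carrier
    1/deg v = 1/ℕ_ (degree Γ v) {{>-nonZero (noIso v)}}

    deg-*-1/deg : ∀ v → fromℕ (degree Γ v) * 1/deg v ≈ 1#
    deg-*-1/deg v = fromℕ-*-1/ℕ (degree Γ v) {{>-nonZero (noIso v)}}

    adjacency≈ : ∀ v w → adjacency F Γ v w ≈ - fromℕ (codegree-off-diagonal Γ v w)
    adjacency≈ v w with v Fin.≟ w
    ... | yes _ = sym -0≈0
    ... | no  _ = refl

    -- The adjacency entries are negative and `L` subtracts them, so the two signs cancel and the
    -- sum over neighbours enters with a plus.
    laplacian-apply : ∀ f v → matApply F (laplacian F Γ noIso) f v ≈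
      f v + 1/deg v * ∑ᶠ.sum (λ w → fromℕ (codegree-off-diagonal Γ v w) * f w)
    laplacian-apply f v = begin
      ∑ᶠ.sum (λ w → laplacian F Γ noIso v w * f w)
        ≈⟨ ∑ᶠ.sum-cong-≋ term ⟩
      ∑ᶠ.sum (λ w → identity F v w * f w + 1/deg v * (o w * f w))
        ≈⟨ ∑ᶠ.∑-distrib-+ (λ w → identity F v w * f w) _ ⟩
      ∑ᶠ.sum (λ w → identity F v w * f w) + ∑ᶠ.sum (λ w → 1/deg v * (o w * f w))
        ≈⟨ +-cong (trans (sum-diagonal (λ _ → 1#) f v) (*-identityˡ (f v)))
             (sym (∑ᶠ.*-distribˡ-sum (1/deg v) (λ w → o w * f w))) ⟩
      f v + 1/deg v * ∑ᶠ.sum (λ w → o w * f w) ∎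
      where
      o : Fin n → Carrier
      o w = fromℕ (codegree-off-diagonal Γ v w)
      term : ∀ w → laplacian F Γ noIso v w * f w ≈ identity F v w * f w + 1/deg v * (o w * f w)
      term w = begin
        (identity F v w - matMul F (inverseDegree F Γ noIso) (adjacency F Γ) v w) * f w
          ≈⟨ *-congʳ (+-congˡ (-‿cong (sum-diagonal 1/deg (λ u → adjacency F Γ u w) v))) ⟩
        (identity F v w - 1/deg v * adjacency F Γ v w) * f w
          ≈⟨ *-congʳ (+-congˡ (-‿cong (*-congˡ (adjacency≈ v w)))) ⟩
        (identity F v w - 1/deg v * - o w) * f w
          ≈⟨ *-congʳ (+-congˡ (trans (-‿cong (sym (-‿distribʳ-* _ _))) (-‿involutive _))) ⟩
        (identity F v w + 1/deg v * o w) * f w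
          ≈⟨ distribʳ _ _ _ ⟩
        identity F v w * f w + 1/deg v * o w * f w
          ≈⟨ +-congˡ (*-assoc _ _ _) ⟩
        identity F v w * f w + 1/deg v * (o w * f w) ∎

  -- Color differences as differences of indicators.

  module _ {n k} (κ : Fin n → Fin k) where

    χᶠ : Fin k → Fin n → Carrier
    χᶠ i w = fromℕ (χ κ i w)

    χᶠ-own-class : ∀ {i v} → κ v ≡ i → χᶠ i v ≈ 1#
    χᶠ-own-class {i} {v} κv≡i = trans (fromℕ-cong (indicator-true (κ v Fin.≟ i) κv≡i)) (×-homo-1 1#)

    χᶠ-other-class : ∀ {i v} → κ v ≢ i → χᶠ i v ≈ 0#
    χᶠ-other-class {i} {v} κv≢i = fromℕ-cong (indicator-false (κ v Fin.≟ i) κv≢i)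

    -- A linear formula in place of the case distinction. As `i ≢ j`, no vertex lies in both
    -- classes, where the two sides would be 1 and 0.
    colorDifference≈ : ∀ {i j} → i ≢ j → ∀ w → colorDifference F κ i j w ≈ χᶠ i w - χᶠ j w
    colorDifference≈ {i} {j} i≢j w with w ∈? colorClass κ i | w ∈? colorClass κ j
    ... | yes w∈Vᵢ | _ = sym (begin
      χᶠ i w - χᶠ j w ≈⟨ +-cong (χᶠ-own-class κw≡i) (-‿cong (χᶠ-other-class λ κw≡j → i≢j (≡.trans (≡.sym κw≡i) κw≡j))) ⟩
      1# - 0#         ≈⟨ trans (+-congˡ -0≈0) (+-identityʳ 1#) ⟩
      1#              ∎)
      where κw≡i = ∈colorClass⁻ κ w∈Vᵢ
    ... | no w∉Vᵢ | yes w∈Vⱼ = sym (trans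
      (+-cong (χᶠ-other-class (w∉Vᵢ ∘ ∈colorClass⁺ κ)) (-‿cong (χᶠ-own-class (∈colorClass⁻ κ w∈Vⱼ)))) (+-identityˡ _))
    ... | no w∉Vᵢ | no w∉Vⱼ = sym (trans
      (+-cong (χᶠ-other-class (w∉Vᵢ ∘ ∈colorClass⁺ κ)) (-‿cong (χᶠ-other-class (w∉Vⱼ ∘ ∈colorClass⁺ κ)))) (-‿inverseʳ 0#))

    colorDifference-own-class : ∀ {i j v} → κ v ≡ i → colorDifference F κ i j v ≈ 1#
    colorDifference-own-class {i} {j} {v} κv≡i with v ∈? colorClass κ i | v ∈? colorClass κ j
    ... | yes _    | _ = refl
    ... | no  v∉Vᵢ | _ = contradiction (∈colorClass⁺ κ κv≡i) v∉Vᵢ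

  -- The Laplacian on color differences.

  module _ {n} (Γ : Hypergraph n) (noIso : NoIsolatedVertices Γ)
           {k} (κ : Fin n → Fin k) (proper : ProperStrongColoring Γ κ) where

    private
      L = laplacian F Γ noIso
      g = colorDifference F κ
      B : Fin k → Fin n → Carrier
      B i v = fromℕ (neighbours Γ κ proper i v)

    -- Linearity splits the sum over neighbours into one sum per color, each the image of a natural
    -- number.
    laplacian-colorDifference : ∀ {i j} → i ≢ j → ∀ v →
      matApply F L (g i j) v ≈ g i j v + 1/deg Γ noIso v * (B i v - B j v)
    laplacian-colorDifference {i} {j} i≢j v = trans (laplacian-apply Γ noIso (g i j) v) (+-congˡ (*-congˡ (begin
      ∑ᶠ.sum (λ w → fromℕ (o w) * g i j w)
        ≈⟨ ∑ᶠ.sum-cong-≋ (λ w → trans (*-congˡ (colorDifference≈ κ i≢j w)) (trans (x[y-z]≈xy-xz _ _ _)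
             (sym (+-cong (×1-homo-* (o w) (χ κ i w)) (-‿cong (×1-homo-* (o w) (χ κ j w))))))) ⟩
      ∑ᶠ.sum (λ w → fromℕ (o w ℕ.* χ κ i w) - fromℕ (o w ℕ.* χ κ j w))
        ≈⟨ sum-distrib-- (λ w → fromℕ (o w ℕ.* χ κ i w)) _ ⟩
      ∑ᶠ.sum (λ w → fromℕ (o w ℕ.* χ κ i w)) - ∑ᶠ.sum (λ w → fromℕ (o w ℕ.* χ κ j w))
        ≈⟨ +-cong (fromℕ-sum (λ w → o w ℕ.* χ κ i w)) (-‿cong (fromℕ-sum (λ w → o w ℕ.* χ κ j w))) ⟨
      B i v - B j v ∎)))
      where
      o : Fin n → ℕ
      o = codegree-off-diagonal Γ v

    -- On a vertex of a third class the eigenvalue equation for gᵢⱼ has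
    -- right-hand side 0, whatever the eigenvalue.
    eigenfunction⇒edgesMeeting-equal : ∀ {i j} → i ≢ j → Eigenfunction F L (g i j) →
      ∀ v → κ v ≢ i → κ v ≢ j → edgesMeeting Γ v (colorClass κ i) ≡ edgesMeeting Γ v (colorClass κ j)
    eigenfunction⇒edgesMeeting-equal {i} {j} i≢j (μ , _ , Lg≈μg) v κv≢i κv≢j =
      ≡.trans (≡.sym (neighbours-other-class Γ κ proper κv≢i))
        -- Multiplying by `deg v` undoes the factor `1/deg v`; injectivity of `fromℕ` then returns
        -- to ℕ.
        (≡.trans (fromℕ-injective (x∙y⁻¹≈ε⇒x≈y _ _ (begin
            B i v - B j v
              ≈⟨ *-identityˡ _ ⟨
            1# * (B i v - B j v)
              ≈⟨ *-congʳ (deg-*-1/deg Γ noIso v) ⟨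
            fromℕ (degree Γ v) * 1/deg Γ noIso v * (B i v - B j v)
              ≈⟨ *-assoc _ _ _ ⟩
            fromℕ (degree Γ v) * (1/deg Γ noIso v * (B i v - B j v))
              ≈⟨ *-congˡ vanish ⟩
            fromℕ (degree Γ v) * 0#
              ≈⟨ zeroʳ _ ⟩
            0# ∎)))
          (neighbours-other-class Γ κ proper κv≢j))
      where
      g≈0 : g i j v ≈ 0#
      g≈0 = trans (colorDifference≈ κ i≢j v)
        (trans (+-cong (χᶠ-other-class κ κv≢i) (-‿cong (χᶠ-other-class κ κv≢j))) (-‿inverseʳ 0#))
      vanish : 1/deg Γ noIso v * (B i v - B j v) ≈ 0#
      vanish = begin
        1/deg Γ noIso v * (B i v - B j v)            ≈⟨ +-identityˡ _ ⟨
        0# + 1/deg Γ noIso v * (B i v - B j v)       ≈⟨ +-congʳ g≈0 ⟨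
        g i j v + 1/deg Γ noIso v * (B i v - B j v)  ≈⟨ laplacian-colorDifference i≢j v ⟨
        matApply F L (g i j) v                       ≈⟨ Lg≈μg v ⟩
        μ * g i j v                                  ≈⟨ *-congˡ g≈0 ⟩
        μ * 0#                                       ≈⟨ zeroʳ μ ⟩
        0#                                           ∎

    -- From equidistribution to the eigenvalue.

    module _ {c} (2≤c : 2 ≤ c) (2≤k : 2 ≤ k) (equi : Equidistributed Γ c κ) where

      private
        instance _ = 2≤⇒nonZero-pred 2≤k
        s : Carrier
        s = fromℕ (c ∸ 1) * 1/ℕ (k ∸ 1)

      1-s≈colorEigenvalue : 1# - s ≈ colorEigenvalue F c k 2≤k
      1-s≈colorEigenvalue = begin
        1# - s
          ≈⟨ +-congʳ (fromℕ-*-1/ℕ (k ∸ 1)) ⟨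
        fromℕ (k ∸ 1) * 1/ℕ (k ∸ 1) - fromℕ (c ∸ 1) * 1/ℕ (k ∸ 1)
          ≈⟨ [y-z]x≈yx-zx _ _ _ ⟨
        (fromℕ (k ∸ 1) - fromℕ (c ∸ 1)) * 1/ℕ (k ∸ 1)
          ≈⟨ *-congʳ (shift 2≤k 2≤c) ⟩
        (fromℕ k - fromℕ c) * 1/ℕ (k ∸ 1) ∎
        where
        -- Once `k` and `c` are successors, `fromℕ` unfolds to `1#` plus the image of the
        -- predecessor, and the two ones cancel.
        shift : ∀ {k c} → 2 ≤ k → 2 ≤ c → fromℕ (k ∸ 1) - fromℕ (c ∸ 1) ≈ fromℕ k - fromℕ c
        shift (s≤s {n = k-1} _) (s≤s {n = c-1} _) = begin
          fromℕ k-1 - fromℕ c-1                   ≈⟨ +-identityˡ _ ⟨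
          0# + (fromℕ k-1 - fromℕ c-1)            ≈⟨ +-congʳ (-‿inverseʳ 1#) ⟨
          1# - 1# + (fromℕ k-1 - fromℕ c-1)       ≈⟨ interchange _ _ _ _ ⟩
          1# + fromℕ k-1 + (- 1# - fromℕ c-1)     ≈⟨ +-congˡ (⁻¹-∙-comm _ _) ⟩
          fromℕ (ℕ.suc k-1) - fromℕ (ℕ.suc c-1)   ∎

      -- Both sides are 0 on `Vᵢ` and `s` off it. A formula linear in the indicator spares a case
      -- distinction when `i` and `j` are combined.
      1/deg-*-neighbours : ∀ i v → 1/deg Γ noIso v * B i v ≈ s - s * χᶠ κ i v
      1/deg-*-neighbours i v with κ v Fin.≟ i
      ... | yes κv≡i = begin
        1/deg Γ noIso v * B i v  ≈⟨ *-congˡ (fromℕ-cong (neighbours-own-class Γ κ proper κv≡i)) ⟩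
        1/deg Γ noIso v * 0#     ≈⟨ zeroʳ _ ⟩
        0#                       ≈⟨ -‿inverseʳ s ⟨
        s - s                    ≈⟨ +-congˡ (-‿cong (trans (*-congˡ (×-homo-1 1#)) (*-identityʳ s))) ⟨
        s - s * fromℕ 1          ∎
      ... | no κv≢i = begin
        1/d * B i v                     ≈⟨ *-congˡ (fromℕ-cong (neighbours-other-class Γ κ proper κv≢i)) ⟩
        -- The factor `1 = (k - 1) q` is inserted to produce `A (k - 1)`, which equidistribution
        -- rewrites.
        1/d * A                         ≈⟨ *-congˡ (trans (*-congˡ (fromℕ-*-1/ℕ (k ∸ 1))) (*-identityʳ A)) ⟨
        1/d * (A * (fromℕ (k ∸ 1) * q)) ≈⟨ *-congˡ (trans (sym (*-assoc _ _ _)) (*-congʳ A[k-1]≈[c-1]d)) ⟩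
        1/d * (fromℕ (c ∸ 1) * d * q)   ≈⟨ *-congˡ (trans (*-congʳ (*-comm _ _)) (*-assoc _ _ _)) ⟩
        1/d * (d * s)                   ≈⟨ *-assoc _ _ _ ⟨
        1/d * d * s                     ≈⟨ *-congʳ (trans (*-comm _ _) (deg-*-1/deg Γ noIso v)) ⟩
        1# * s                          ≈⟨ *-identityˡ s ⟩
        s                               ≈⟨ +-identityʳ s ⟨
        s + 0#                          ≈⟨ +-congˡ (trans (-‿cong (zeroʳ s)) -0≈0) ⟨
        s - s * 0#                      ∎
        where
        1/d = 1/deg Γ noIso v
        d   = fromℕ (degree Γ v)
        q   = 1/ℕ (k ∸ 1)
        A   = fromℕ (edgesMeeting Γ v (colorClass κ i))
        A[k-1]≈[c-1]d : A * fromℕ (k ∸ 1) ≈ fromℕ (c ∸ 1) * d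
        A[k-1]≈[c-1]d = trans (sym (×1-homo-* (edgesMeeting Γ v (colorClass κ i)) (k ∸ 1)))
          (trans (fromℕ-cong (equi i v κv≢i)) (×1-homo-* (c ∸ 1) (degree Γ v)))

      -- The constants `s` for `i` and `j` cancel, and what remains of the neighbour term is `- s`
      -- times `g i j`.
      equidistributed⇒eigenvalue-equation : ∀ {i j} → i ≢ j → ∀ v →
        matApply F L (g i j) v ≈ colorEigenvalue F c k 2≤k * g i j v
      equidistributed⇒eigenvalue-equation {i} {j} i≢j v = begin
        matApply F L (g i j) v
          ≈⟨ laplacian-colorDifference i≢j v ⟩
        g i j v + 1/deg Γ noIso v * (B i v - B j v)
          ≈⟨ +-congˡ (trans (x[y-z]≈xy-xz _ _ _)
               (+-cong (1/deg-*-neighbours i v) (-‿cong (1/deg-*-neighbours j v)))) ⟩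
        g i j v + (s - s * χᶠ κ i v - (s - s * χᶠ κ j v))
          ≈⟨ +-congˡ (+-congˡ (⁻¹-∙-comm s (- (s * χᶠ κ j v)))) ⟨
        g i j v + (s - s * χᶠ κ i v + (- s - - (s * χᶠ κ j v)))
          ≈⟨ +-congˡ (trans (interchange _ _ _ _) (trans (+-congʳ (-‿inverseʳ s)) (+-identityˡ _))) ⟩
        g i j v + (- (s * χᶠ κ i v) - - (s * χᶠ κ j v))
          ≈⟨ +-congˡ (⁻¹-∙-comm _ _) ⟩
        g i j v - (s * χᶠ κ i v - s * χᶠ κ j v)
          ≈⟨ +-congˡ (-‿cong (x[y-z]≈xy-xz _ _ _)) ⟨
        g i j v - s * (χᶠ κ i v - χᶠ κ j v)
          ≈⟨ +-congˡ (-‿cong (*-congˡ (colorDifference≈ κ i≢j v))) ⟨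
        g i j v - s * g i j v
          ≈⟨ +-congʳ (*-identityˡ _) ⟨
        1# * g i j v - s * g i j v
          ≈⟨ [y-z]x≈yx-zx _ _ _ ⟨
        (1# - s) * g i j v
          ≈⟨ *-congʳ 1-s≈colorEigenvalue ⟩
        colorEigenvalue F c k 2≤k * g i j v ∎

      -- At a vertex of color `i` the function equals 1: there the eigenvalue equation determines
      -- `μ`, and the function is seen to be nonzero.
      eigenfunctionWith⇔ : 1 ≤ n → ∀ {i j} → i ≢ j → ∀ μ →
        EigenfunctionWith F L μ (g i j) ⇔ μ ≈ colorEigenvalue F c k 2≤k
      eigenfunctionWith⇔ 1≤n {i} {j} i≢j μ = mk⇔
        (λ (_ , Lg≈μg) → begin
          μ                                     ≈⟨ *-identityʳ μ ⟨
          μ * 1#                                ≈⟨ *-congˡ g≈1 ⟨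
          μ * g i j v                           ≈⟨ Lg≈μg v ⟨
          matApply F L (g i j) v                ≈⟨ equidistributed⇒eigenvalue-equation i≢j v ⟩
          colorEigenvalue F c k 2≤k * g i j v   ≈⟨ *-congˡ g≈1 ⟩
          colorEigenvalue F c k 2≤k * 1#        ≈⟨ *-identityʳ _ ⟩
          colorEigenvalue F c k 2≤k             ∎)
        (λ μ≈ → (λ g≈0 → 1≉0 (trans (sym g≈1) (g≈0 v)))
              , (λ w → trans (equidistributed⇒eigenvalue-equation i≢j w) (*-congʳ (sym μ≈))))
        where
        inhabited = equidistributed⇒surjective Γ 2≤c κ 1≤n noIso equi i
        v = proj₁ inhabited
        g≈1 : g i j v ≈ 1#
        g≈1 = colorDifference-own-class κ (proj₂ inhabited)

-- The equivalence and its eigenvalue.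

mainTheorem9 : {a ℓ₁ ℓ₂ : Level} (F : CharZeroField a ℓ₁ ℓ₂) →
    let open CharZeroField F using (_≈_) in
    (n : ℕ) → 1 ≤ n →
    (c : ℕ) → 2 ≤ c →
    (Γ : Hypergraph n) → Uniform Γ c → (noIso : NoIsolatedVertices Γ) →
    (k : ℕ) (2≤k : 2 ≤ k) →
    (κ : Fin n → Fin k) → ProperStrongColoring Γ κ →
    ((∀ i j → i ≢ j → Eigenfunction F (laplacian F Γ noIso) (colorDifference F κ i j))
    ⇔ CountingCondition Γ c 2≤k κ)
    ×
    (CountingCondition Γ c 2≤k κ →
    ∀ i j → i ≢ j → ∀ μ →
    EigenfunctionWith F (laplacian F Γ noIso) μ (colorDifference F κ i j)
    ⇔ μ ≈ colorEigenvalue F c k 2≤k)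
mainTheorem9 F n 1≤n c 2≤c Γ uniform noIso k 2≤k κ proper =
    mk⇔
      (λ eigen → equidistributed⇒counting Γ c 2≤k κ proper
        (constant-off-own-class⇒equidistributed Γ 2≤c 2≤k κ uniform proper
          λ i j v i≢j → eigenfunction⇒edgesMeeting-equal F Γ noIso κ proper i≢j (eigen i j i≢j) v))
      -- The converse is a case of the second claim: with the eigenvalue itself as witness, the
      -- equation for `μ` is reflexivity.
      (λ counting i j i≢j → colorEigenvalue F c k 2≤k
        , Equivalence.from (eigenvalue⇔ counting i j i≢j _) (CharZeroField.refl F))
  , eigenvalue⇔
  where
  open CharZeroField F using (_≈_)
  eigenvalue⇔ : CountingCondition Γ c 2≤k κ → ∀ i j → i ≢ j → ∀ μ →
    EigenfunctionWith F (laplacian F Γ noIso) μ (colorDifference F κ i j) ⇔ μ ≈ colorEigenvalue F c k 2≤k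
  eigenvalue⇔ counting i j i≢j = eigenfunctionWith⇔ F Γ noIso κ proper 2≤c 2≤k
    (counting⇒equidistributed Γ c 2≤k κ counting) 1≤n i≢j
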